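{- Define $g(1)=1$, $g(2^k-1)=(-1)^k$ for every integer $k>1$, and $g(n)=0$ for all other integers $n\ge 0$. Let $r(n)$ be the Golay–Rudin–Shapiro sequence, defined by $r(0)=1$, $r(2n)=r(n)$, $r(2n+1)=(-1)^n r(n)$ for $n\ge 0$. Then for all $n\ge 0$, $$\det\left(g(i+j+1)\right)_{i,j=0}^{n-1}=r(n),$$ where the determinant of the empty ($n=0$) matrix is $1$.
   Context: Equivalently, $r(n)=(-1)^{\rho(n)}$ where $\rho(n)$ is the number of (possibly overlapping) pairs of adjacent digits $11$ in the binary expansion of $n$. -}

module Defs where

open import Algebra.Properties.Semiring.Sum using (sum)
open import Data.Fin.Base using (zero; suc; toℕ)
open import Data.Integer.Base using (ℤ; 0ℤ; 1ℤ; -1ℤ; _*_; _^_)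
import Data.Integer.Properties as ℤ
open import Data.Nat.Base as ℕ using (ℕ; zero; suc; _<_; z≤n; s≤s; _∸_; _/_; _%_)
open import Data.Nat.DivMod using (m/n<m; m*n/n≡m; m*n%n≡0; [m+kn]%n≡m%n; +-distrib-/-∣ʳ)
open import Data.Nat.Divisibility using (divides-refl)
open import Data.Nat.Induction using (<-wellFounded; <-rec; <-Rec)
import Data.Nat.Properties as ℕ
open import Data.Product.Base using (∃; _×_; _,_)
open import Data.Vec.Functional using (Vector; removeAt)
open import Induction.WellFounded using (module FixPoint)
open import Relation.Binary.PropositionalEquality
  using (_≡_; _≢_; refl; sym; trans; cong)
open import Relation.Nullary using (Dec; yes; no; ¬_; contradiction)
open import Relation.Nullary.Decidable using (map′; _×-dec_)

-- Laplace expansion along the first row.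
det : ∀ {n} → Vector (Vector ℤ n) n → ℤ
det {zero}  _ = 1ℤ
det {suc n} M = sum ℤ.+-*-semiring λ j →
  -1ℤ ^ toℕ j * M zero j * det (λ i → removeAt (M (suc i)) j)

MersenneExponent : ℕ → ℕ → Set
MersenneExponent n k = 1 < k × n ≡ 2 ℕ.^ k ∸ 1

private
  k<2^k : ∀ k → k < 2 ℕ.^ k
  k<2^k zero    = s≤s z≤n
  k<2^k (suc k) = begin
    suc (suc k)                 ≤⟨ s≤s (k<2^k k) ⟩
    1 ℕ.+ 2 ℕ.^ k               ≤⟨ ℕ.+-monoˡ-≤ _ (ℕ.m^n>0 2 k) ⟩
    2 ℕ.^ k ℕ.+ 2 ℕ.^ k         ≡⟨ cong (2 ℕ.^ k ℕ.+_) (ℕ.+-identityʳ _) ⟨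
    2 ℕ.^ suc k                 ∎
    where open ℕ.≤-Reasoning

  exponent-bound : ∀ {n k} → MersenneExponent n k → k < suc n
  exponent-bound {k = k} (_ , refl) = s≤s (ℕ.<⇒≤pred (k<2^k k))

  exponent-unique : ∀ {n k l} → MersenneExponent n k → MersenneExponent n l → k ≡ l
  exponent-unique {n} {k} {l} (_ , p) (_ , q) =
    ℕ.≤-antisym (ℕ.≮⇒≥ (lt⇒≢ (sym eq))) (ℕ.≮⇒≥ (lt⇒≢ eq))
    where
    eq : 2 ℕ.^ k ≡ 2 ℕ.^ l
    eq = ℕ.∸-cancelʳ-≡ (ℕ.m^n>0 2 k) (ℕ.m^n>0 2 l) (trans (sym p) q)
    lt⇒≢ : ∀ {a b} → 2 ℕ.^ a ≡ 2 ℕ.^ b → ¬ a < b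
    lt⇒≢ e a<b = ℕ.<⇒≢ (ℕ.^-monoʳ-< 2 (s≤s (s≤s z≤n)) a<b) e

  exponent-of-1 : ∀ {k} → ¬ MersenneExponent 1 k
  exponent-of-1 e@(1<k , _) =
    ℕ.<⇒≱ 1<k (ℕ.≤-pred (exponent-bound e))

mersenneExponent? : ∀ n → Dec (∃ (MersenneExponent n))
mersenneExponent? n = map′
  (λ (k , _ , e) → k , e)
  (λ (k , e) → k , exponent-bound e , e)
  (ℕ.anyUpTo? (λ k → (1 ℕ.<? k) ×-dec (n ℕ.≟ 2 ℕ.^ k ∸ 1)) (suc n))

g : ℕ → ℤ
g 1 = 1ℤ
g n with mersenneExponent? n
... | yes (k , _) = -1ℤ ^ k
... | no  _       = 0ℤ

private
  g-exponent : ∀ n {k} → MersenneExponent n k → g n ≡ -1ℤ ^ k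
  g-exponent 1 e = contradiction e exponent-of-1
  g-exponent zero e@(1<k , _) =
    contradiction (ℕ.<-trans 1<k (exponent-bound e)) (ℕ.<-irrefl refl)
  g-exponent n@(suc (suc _)) e with mersenneExponent? n
  ... | yes (_ , e′) = cong (-1ℤ ^_) (exponent-unique e′ e)
  ... | no  ¬e       = contradiction (_ , e) ¬e

g-1 : g 1 ≡ 1ℤ
g-1 = refl

g-2^k∸1 : ∀ k → 1 < k → g (2 ℕ.^ k ∸ 1) ≡ -1ℤ ^ k
g-2^k∸1 k 1<k = g-exponent _ (1<k , refl)

g-other : ∀ n → n ≢ 1 → (∀ k → 1 < k → n ≢ 2 ℕ.^ k ∸ 1) → g n ≡ 0ℤ
g-other 1 n≢1 _ = contradiction refl n≢1
g-other zero _ _ = refl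
g-other n@(suc (suc _)) _ h with mersenneExponent? n
... | yes (k , 1<k , e) = contradiction e (h k 1<k)
... | no  _             = refl

private
  r-step : ∀ n → <-Rec (λ _ → ℤ) n → ℤ
  r-step zero      _   = 1ℤ
  r-step n@(suc _) rec with n % 2
  ... | zero  = rec (m/n<m n 2 (s≤s (s≤s z≤n)))
  ... | suc _ = -1ℤ ^ (n / 2) * rec (m/n<m n 2 (s≤s (s≤s z≤n)))

-- The Golay–Rudin–Shapiro sequence, by well-founded recursion on n ↦ n / 2;
-- its defining equations are r-0, r-2n and r-2n+1 below.
r : ℕ → ℤ
r = <-rec (λ _ → ℤ) r-step

private
  r-unfold : ∀ n → r n ≡ r-step n (λ {m} _ → r m)
  r-unfold n = FixPoint.unfold-wfRec <-wellFounded (λ _ → ℤ) r-step ext {n}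
    where
    ext : ∀ n {f h : <-Rec (λ _ → ℤ) n} →
          (∀ {m} m<n → f {m} m<n ≡ h m<n) → r-step n f ≡ r-step n h
    ext zero      _ = refl
    ext n@(suc _) e with n % 2
    ... | zero  = e _
    ... | suc _ = cong (-1ℤ ^ (n / 2) *_) (e _)

  r-even : ∀ n m → n % 2 ≡ 0 → n / 2 ≡ m → r n ≡ r m
  r-even zero      _ _ refl = refl
  r-even n@(suc _) _ p refl rewrite r-unfold n with n % 2 | p
  ... | zero | refl = refl

  r-odd : ∀ n m → n % 2 ≡ 1 → n / 2 ≡ m → r n ≡ -1ℤ ^ m * r m
  r-odd n@(suc _) _ p refl rewrite r-unfold n with n % 2 | p
  ... | suc _ | refl = refl

r-0 : r 0 ≡ 1ℤ
r-0 = refl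

r-2n : ∀ n → r (2 ℕ.* n) ≡ r n
r-2n n rewrite ℕ.*-comm 2 n = r-even (n ℕ.* 2) n (m*n%n≡0 n 2) (m*n/n≡m n 2)

r-2n+1 : ∀ n → r (2 ℕ.* n ℕ.+ 1) ≡ -1ℤ ^ n * r n
r-2n+1 n rewrite ℕ.*-comm 2 n | ℕ.+-comm (n ℕ.* 2) 1 =
  r-odd (1 ℕ.+ n ℕ.* 2) n ([m+kn]%n≡m%n 1 n 2)
    (trans (+-distrib-/-∣ʳ 1 {n ℕ.* 2} {2} (divides-refl n)) (m*n/n≡m n 2))

{-# OPTIONS --safe #-}
module Submission where

-- Write n = 2^q + u with 0 ≤ u < 2^q, and put h = 2^q - 1, c = h - u.  In the
-- last row of the n × n Hankel matrix the only possible index sum of the form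
-- 2^k - 2 is 2h, so this row has a single nonzero entry, in column c; by
-- symmetry the last column has a single nonzero entry, in row c.  Expanding
-- along both removes the indices c and n - 1 and contributes
-- - g(2h+1)² = -1.  The remaining matrix has the same shape, so after u such
-- steps, and one last row expansion at the midpoint h, only the c × c Hankel
-- matrix is left:
--   det H_n = (-1)^u g(2^(q+1) - 1) det H_c.
-- The sequence r satisfies the same recursion, by induction on q.

open import Defs
import Algebra.Properties.Semiring.Sum as Sum
open import Data.Fin.Base using (Fin; zero; suc; toℕ; fromℕ; fromℕ<; inject₁; punchIn; pinch)
open import Data.Fin.Properties
  using (toℕ<n; toℕ-fromℕ; toℕ-fromℕ<; toℕ-inject₁;
         toℕ-injective; inject₁-injective; punchIn-injective; punchInᵢ≢i)
open import Data.Integer.Base as ℤ using (ℤ; 0ℤ; 1ℤ; -1ℤ; -_; _*_; _^_)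
import Data.Integer.Properties as ℤ
open import Data.Integer.Solver using (module +-*-Solver)
open import Data.Nat.Base as ℕ using (ℕ; zero; suc; _+_; _∸_; _≤_; _<_; z≤n; s≤s)
open import Data.Nat.Induction using (<-rec)
import Data.Nat.Properties as ℕ
import Data.Nat.Solver as ℕ
open import Data.Product.Base using (∃; _×_; _,_)
open import Data.Vec.Functional using (Vector; removeAt)
open import Function.Base using (_∘_)
open import Relation.Binary.PropositionalEquality
  using (_≡_; _≢_; refl; sym; trans; cong; cong₂; subst; subst₂; module ≡-Reasoning)

private
  module Σ = Sum ℤ.+-*-semiring

private
  variable
    n : ℕ

-- Laplace expansion along a row or column with a single nonzero entry.

Matrix : ℕ → Set
Matrix n = Vector (Vector ℤ n) n

minor : Matrix (suc n) → Fin (suc n) → Fin (suc n) → Matrix n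
minor M i p k l = M (punchIn i k) (punchIn p l)

det-cong : {M N : Matrix n} → (∀ i j → M i j ≡ N i j) → det M ≡ det N
det-cong {zero}  M≗N = refl
det-cong {suc n} M≗N = Σ.sum-cong-≗ λ j →
  cong₂ _*_ (cong (-1ℤ ^ toℕ j *_) (M≗N zero j))
    (det-cong λ k l → M≗N (suc k) (punchIn j l))

sum-zero : {t : Vector ℤ n} → (∀ i → t i ≡ 0ℤ) → Σ.sum t ≡ 0ℤ
sum-zero {n} t≗0 = trans (Σ.sum-cong-≗ t≗0) (Σ.sum-replicate-zero n)

-- Once column `punchIn p l` is deleted, the old column `p` stands at position `pinch l p`.
punchIn-pinch : (p : Fin (suc (suc n))) (l : Fin (suc n)) →
  punchIn (punchIn p l) (pinch l p) ≡ p
punchIn-pinch zero    l       = refl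
punchIn-pinch (suc p) zero    = refl
punchIn-pinch {suc n} (suc p) (suc l) = cong suc (punchIn-pinch p l)

-- The same two columns are deleted on both sides, in opposite orders.
punchIn-punchIn-pinch : (p : Fin (suc (suc n))) (l : Fin (suc n)) (k : Fin n) →
  punchIn (punchIn p l) (punchIn (pinch l p) k) ≡ punchIn p (punchIn l k)
punchIn-punchIn-pinch zero    l       k       = refl
punchIn-punchIn-pinch (suc p) zero    k       = refl
punchIn-punchIn-pinch (suc p) (suc l) zero    = refl
punchIn-punchIn-pinch (suc p) (suc l) (suc k) = cong suc (punchIn-punchIn-pinch p l k)

neg-*-neg : ∀ x y → (-1ℤ * x) * (-1ℤ * y) ≡ x * y
neg-*-neg = solve 2 (λ x y → (con -1ℤ :* x) :* (con -1ℤ :* y) := x :* y) refl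
  where open +-*-Solver

sign-square : ∀ k → -1ℤ ^ k * -1ℤ ^ k ≡ 1ℤ
sign-square zero    = refl
sign-square (suc k) = trans (neg-*-neg (-1ℤ ^ k) (-1ℤ ^ k)) (sign-square k)

sign-double : ∀ k → -1ℤ ^ (k ℕ.* 2) ≡ 1ℤ
sign-double zero    = refl
sign-double (suc k) = trans (sym (ℤ.*-assoc -1ℤ -1ℤ _)) (trans (ℤ.*-identityˡ _) (sign-double k))

-- Of two deleted columns, the one deleted second is shifted down by one exactly when it lies to the
-- right of the first. So the two orders of deletion give exponents that differ by one.
sign-pinch : (p : Fin (suc (suc n))) (l : Fin (suc n)) →
  -1ℤ ^ toℕ (punchIn p l) * -1ℤ ^ toℕ (pinch l p) ≡ - (-1ℤ ^ toℕ p * -1ℤ ^ toℕ l)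
sign-pinch zero    l    = solve 1 (λ x → con -1ℤ :* x :* con 1ℤ := :- (con 1ℤ :* x)) refl (-1ℤ ^ toℕ l)
  where open +-*-Solver
sign-pinch (suc p) zero =
  solve 1 (λ x → con 1ℤ :* x := :- (con -1ℤ :* x :* con 1ℤ)) refl (-1ℤ ^ toℕ p)
  where open +-*-Solver
sign-pinch {suc n} (suc p) (suc l) = begin
  (-1ℤ * a) * (-1ℤ * b)     ≡⟨ neg-*-neg a b ⟩
  a * b                     ≡⟨ sign-pinch p l ⟩
  - (c * d)                 ≡⟨ cong -_ (neg-*-neg c d) ⟨
  - ((-1ℤ * c) * (-1ℤ * d)) ∎
  where
  open ≡-Reasoning
  a = -1ℤ ^ toℕ (punchIn p l)
  b = -1ℤ ^ toℕ (pinch l p)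
  c = -1ℤ ^ toℕ p
  d = -1ℤ ^ toℕ l

-- The Laplace expansion when a single term survives. Naming it lets sparse rows and sparse columns
-- share one induction step.
ExpandsAt : Matrix (suc n) → Fin (suc n) → Fin (suc n) → Set
ExpandsAt M i p = det M ≡ -1ℤ ^ (toℕ i + toℕ p) * (M i p * det (minor M i p))

expandsAt-zero : (M : Matrix (suc n)) (i p : Fin (suc n)) →
  M i p ≡ 0ℤ → ExpandsAt M i p → det M ≡ 0ℤ
expandsAt-zero M i p Mip≡0 e = begin
  det M                    ≡⟨ e ⟩
  s * (M i p * d)          ≡⟨ cong (λ x → s * (x * d)) Mip≡0 ⟩
  s * (0ℤ * d)             ≡⟨ ℤ.*-zeroʳ s ⟩
  0ℤ                       ∎
  where
  open ≡-Reasoning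
  s = -1ℤ ^ (toℕ i + toℕ p)
  d = det (minor M i p)

-- The hypothesis is about the product because either factor may vanish: the entry if the row is
-- sparse, the minor if the column is.
expandsAt-first : (M : Matrix (suc n)) (p : Fin (suc n)) →
  (∀ l → M zero (punchIn p l) * det (minor M zero (punchIn p l)) ≡ 0ℤ) →
  ExpandsAt M zero p
expandsAt-first M p off = begin
  det M                                    ≡⟨ Σ.sum-remove {i = p} t ⟩
  t p ℤ.+ Σ.sum (removeAt t p)             ≡⟨ cong (ℤ._+_ (t p)) (sum-zero rest) ⟩
  t p ℤ.+ 0ℤ                               ≡⟨ ℤ.+-identityʳ (t p) ⟩
  t p                                      ≡⟨ ℤ.*-assoc (-1ℤ ^ toℕ p) _ _ ⟩
  -1ℤ ^ toℕ p * (M zero p * det (minor M zero p)) ∎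
  where
  open ≡-Reasoning
  t : Vector ℤ _
  t j = -1ℤ ^ toℕ j * M zero j * det (minor M zero j)
  rest : ∀ l → t (punchIn p l) ≡ 0ℤ
  rest l = trans (ℤ.*-assoc (-1ℤ ^ toℕ (punchIn p l)) _ _)
    (trans (cong (-1ℤ ^ toℕ (punchIn p l) *_) (off l)) (ℤ.*-zeroʳ (-1ℤ ^ toℕ (punchIn p l))))

-- Expand along the first row, then each minor at the image of position (`suc i`, `p`). The entry
-- `M (suc i) p` is common to all terms, and the double minors left over are those of the first-row
-- expansion of `minor M (suc i) p`.
expandsAt-suc : (M : Matrix (suc (suc n))) (i : Fin (suc n)) (p : Fin (suc (suc n))) →
  M zero p * det (minor M zero p) ≡ 0ℤ →
  (∀ l → ExpandsAt (minor M zero (punchIn p l)) i (pinch l p)) →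
  ExpandsAt M (suc i) p
expandsAt-suc {n} M i p diag off = begin
  det M                                  ≡⟨ Σ.sum-remove {i = p} t ⟩
  t p ℤ.+ Σ.sum (removeAt t p)           ≡⟨ cong₂ ℤ._+_ tp≡0 (Σ.sum-cong-≗ term) ⟩
  0ℤ ℤ.+ Σ.sum (λ l → x * u l)           ≡⟨ ℤ.+-identityˡ _ ⟩
  Σ.sum (λ l → x * u l)                  ≡⟨ Σ.*-distribˡ-sum x u ⟨
  x * det (minor M (suc i) p)            ≡⟨ ℤ.*-assoc (-1ℤ ^ (suc (toℕ i + toℕ p))) _ _ ⟩
  -1ℤ ^ suc (toℕ i + toℕ p) * (M (suc i) p * det (minor M (suc i) p)) ∎
  where
  open ≡-Reasoning
  open +-*-Solver
  t : Vector ℤ (suc (suc n))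
  t j = -1ℤ ^ toℕ j * M zero j * det (minor M zero j)
  u : Vector ℤ (suc n)
  u l = -1ℤ ^ toℕ l * M zero (punchIn p l) * det (minor (minor M (suc i) p) zero l)
  x : ℤ
  x = -1ℤ ^ suc (toℕ i + toℕ p) * M (suc i) p

  tp≡0 : t p ≡ 0ℤ
  tp≡0 = trans (ℤ.*-assoc (-1ℤ ^ toℕ p) _ _)
    (trans (cong (-1ℤ ^ toℕ p *_) diag) (ℤ.*-zeroʳ (-1ℤ ^ toℕ p)))

  term : ∀ l → t (punchIn p l) ≡ x * u l
  term l = begin
    sj * a * det (minor M zero j)
      ≡⟨ cong (sj * a *_) (off l) ⟩
    sj * a * (-1ℤ ^ (toℕ i + toℕ j′) * (M (suc i) (punchIn j j′) * det (minor (minor M zero j) i j′)))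
      ≡⟨ cong (sj * a *_) (cong₂ _*_ (ℤ.^-distribˡ-+-* -1ℤ (toℕ i) (toℕ j′))
           (cong₂ _*_ (cong (M (suc i)) (punchIn-pinch p l))
             (det-cong λ k m → cong (M (suc (punchIn i k))) (punchIn-punchIn-pinch p l m)))) ⟩
    sj * a * (si * sj′ * (b * d))
      ≡⟨ solve 6 (λ sj a si sj′ b d → sj :* a :* (si :* sj′ :* (b :* d)) := sj :* sj′ :* (si :* a :* b :* d))
           refl sj a si sj′ b d ⟩
    sj * sj′ * (si * a * b * d)
      -- The minus sign obtained here accounts for row `suc i` in place of `i`.
      ≡⟨ cong (_* (si * a * b * d)) (sign-pinch p l) ⟩
    - (sp * sl) * (si * a * b * d)
      ≡⟨ solve 6 (λ sp sl si a b d → :- (sp :* sl) :* (si :* a :* b :* d) :=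
           con -1ℤ :* (si :* sp) :* b :* (sl :* a :* d)) refl sp sl si a b d ⟩
    -1ℤ * (si * sp) * b * u l
      ≡⟨ cong (λ z → -1ℤ * z * b * u l) (ℤ.^-distribˡ-+-* -1ℤ (toℕ i) (toℕ p)) ⟨
    x * u l ∎
    where
    j = punchIn p l
    j′ = pinch l p
    sj = -1ℤ ^ toℕ j
    sj′ = -1ℤ ^ toℕ j′
    si = -1ℤ ^ toℕ i
    sp = -1ℤ ^ toℕ p
    sl = -1ℤ ^ toℕ l
    a = M zero j
    b = M (suc i) p
    d = det (minor (minor M (suc i) p) zero l)

expand-sparse-row : (M : Matrix (suc n)) (i p : Fin (suc n)) →
  (∀ j → j ≢ p → M i j ≡ 0ℤ) → ExpandsAt M i p
expand-sparse-row M zero p sparse = expandsAt-first M p λ l →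
  cong (_* det (minor M zero (punchIn p l))) (sparse (punchIn p l) (punchInᵢ≢i p l))
expand-sparse-row {suc n} M (suc i) p sparse = expandsAt-suc M i p
  -- Without column `p` the row is entirely zero, hence sparse at any column; expanding at column
  -- `zero` shows that this minor has determinant 0.
  (trans (cong (M zero p *_) (expandsAt-zero (minor M zero p) i zero (zeros zero)
           (expand-sparse-row (minor M zero p) i zero λ j _ → zeros j)))
    (ℤ.*-zeroʳ (M zero p)))
  λ l → expand-sparse-row (minor M zero (punchIn p l)) i (pinch l p) λ j j≢ →
    sparse _ λ eq → j≢ (punchIn-injective (punchIn p l) _ _ (trans eq (sym (punchIn-pinch p l))))
  where
  zeros : ∀ j → M (suc i) (punchIn p j) ≡ 0ℤ
  zeros j = sparse _ (punchInᵢ≢i p j)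

-- If the nonzero entry is in the first row, every minor that keeps column `p` has a zero column
-- there, so the induction hypothesis makes its determinant 0. Otherwise those minors inherit the
-- sparse column.
expand-sparse-column : (M : Matrix (suc n)) (i p : Fin (suc n)) →
  (∀ k → k ≢ i → M k p ≡ 0ℤ) → ExpandsAt M i p
expand-sparse-column {zero}  M zero    p sparse = expandsAt-first M p λ ()
expand-sparse-column {suc n} M zero    p sparse = expandsAt-first M p λ l →
  trans (cong (M zero (punchIn p l) *_) (expandsAt-zero (minor M zero (punchIn p l)) zero (pinch l p) (zeros l zero)
          (expand-sparse-column (minor M zero (punchIn p l)) zero (pinch l p) λ k _ → zeros l k)))
    (ℤ.*-zeroʳ (M zero (punchIn p l)))
  where
  zeros : ∀ l k → minor M zero (punchIn p l) k (pinch l p) ≡ 0ℤ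
  zeros l k = trans (cong (M (suc k)) (punchIn-pinch p l)) (sparse (suc k) λ ())
expand-sparse-column {suc n} M (suc i) p sparse = expandsAt-suc M i p
  (cong (_* det (minor M zero p)) (sparse zero λ ()))
  λ l → expand-sparse-column (minor M zero (punchIn p l)) i (pinch l p) λ k k≢i →
    trans (cong (M (suc k)) (punchIn-pinch p l)) (sparse (suc k) λ { refl → k≢i refl })

-- Removing a sparse last row and last column.

punchIn-fromℕ : (k : Fin n) → punchIn (fromℕ n) k ≡ inject₁ k
punchIn-fromℕ zero    = refl
punchIn-fromℕ (suc k) = cong suc (punchIn-fromℕ k)

punchIn-inject₁ : (c : Fin (suc n)) (k : Fin n) →
  punchIn (inject₁ c) (inject₁ k) ≡ inject₁ (punchIn c k)
punchIn-inject₁ zero    k       = refl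
punchIn-inject₁ (suc c) zero    = refl
punchIn-inject₁ (suc c) (suc k) = cong suc (punchIn-inject₁ c k)

punchIn-inject₁-fromℕ : (c : Fin (suc n)) → punchIn (inject₁ c) (fromℕ n) ≡ fromℕ (suc n)
punchIn-inject₁-fromℕ         zero    = refl
punchIn-inject₁-fromℕ {suc n} (suc c) = cong suc (punchIn-inject₁-fromℕ c)

-- After the last row and column `c` are gone, the old last column is still sparse, now with its
-- entry in row `c`. The two sign exponents differ by one, which leaves the factor -1.
det-sparse-border : (M : Matrix (suc (suc n))) (c : Fin (suc n)) →
  (∀ j → j ≢ inject₁ c → M (fromℕ (suc n)) j ≡ 0ℤ) →
  (∀ i → i ≢ inject₁ c → M i (fromℕ (suc n)) ≡ 0ℤ) →
  det M ≡ - (M (fromℕ (suc n)) (inject₁ c) * M (inject₁ c) (fromℕ (suc n))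
             * det (λ i j → M (inject₁ (punchIn c i)) (inject₁ (punchIn c j))))
det-sparse-border {n} M c row column = begin
  det M
    ≡⟨ expand-sparse-row M (fromℕ (suc n)) (inject₁ c) row ⟩
  -1ℤ ^ (suc (toℕ (fromℕ n)) + toℕ (inject₁ c)) * (x * det N)
    ≡⟨ cong₂ (λ k z → -1ℤ ^ (suc (toℕ (fromℕ n)) + k) * (x * z)) (toℕ-inject₁ c)
         (expand-sparse-column N c (fromℕ n) N-column) ⟩
  -1ℤ ^ suc (toℕ (fromℕ n) + toℕ c)
    * (x * (-1ℤ ^ (toℕ c + toℕ (fromℕ n)) * (N c (fromℕ n) * det (minor N c (fromℕ n)))))
    ≡⟨ cong₂ (λ s z → -1ℤ ^ suc (toℕ (fromℕ n) + toℕ c) * (x * (-1ℤ ^ s * z)))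
         (ℕ.+-comm (toℕ c) _)
         (cong₂ _*_ (cong₂ M (punchIn-fromℕ c) (punchIn-inject₁-fromℕ c)) (det-cong N-minor)) ⟩
  -1ℤ * s * (x * (s * (y * d)))
    ≡⟨ solve 4 (λ s x y d → con -1ℤ :* s :* (x :* (s :* (y :* d))) := :- (s :* s :* (x :* y :* d)))
         refl s x y d ⟩
  - (s * s * (x * y * d))
    ≡⟨ cong (λ z → - (z * (x * y * d))) (sign-square (toℕ (fromℕ n) + toℕ c)) ⟩
  - (1ℤ * (x * y * d))
    ≡⟨ cong -_ (ℤ.*-identityˡ (x * y * d)) ⟩
  - (x * y * d) ∎
  where
  open ≡-Reasoning
  open +-*-Solver
  N = minor M (fromℕ (suc n)) (inject₁ c)
  s = -1ℤ ^ (toℕ (fromℕ n) + toℕ c)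
  x = M (fromℕ (suc n)) (inject₁ c)
  y = M (inject₁ c) (fromℕ (suc n))
  d = det (λ i j → M (inject₁ (punchIn c i)) (inject₁ (punchIn c j)))

  N-column : ∀ k → k ≢ c → N k (fromℕ n) ≡ 0ℤ
  N-column k k≢c = trans (cong₂ M (punchIn-fromℕ k) (punchIn-inject₁-fromℕ c))
    (column (inject₁ k) (k≢c ∘ inject₁-injective))

  N-minor : ∀ i j → minor N c (fromℕ n) i j ≡ M (inject₁ (punchIn c i)) (inject₁ (punchIn c j))
  N-minor i j = cong₂ M (punchIn-fromℕ (punchIn c i))
    (trans (cong (punchIn (inject₁ c)) (punchIn-fromℕ j)) (punchIn-inject₁ c j))

-- Hankel matrices with a gap in their indices.

-- Indices of the matrix left after t steps: the values c, …, c + t - 1 are omitted.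
skip : ℕ → ℕ → ℕ → ℕ
skip zero    t k       = t + k
skip (suc c) t zero    = zero
skip (suc c) t (suc k) = suc (skip c t k)

skip-none : ∀ c k → skip c 0 k ≡ k
skip-none zero    k       = refl
skip-none (suc c) zero    = refl
skip-none (suc c) (suc k) = cong suc (skip-none c k)

skip-below : ∀ c t (k : Fin c) → skip c t (toℕ k) ≡ toℕ k
skip-below (suc c) t zero    = refl
skip-below (suc c) t (suc k) = cong suc (skip-below c t k)

skip-above : ∀ c t k → skip c t (c + k) ≡ c + (t + k)
skip-above zero    t k = refl
skip-above (suc c) t k = cong suc (skip-above c t k)

skip-≤ : ∀ c t k → skip c t k ≤ t + k
skip-≤ zero    t k       = ℕ.≤-refl
skip-≤ (suc c) t zero    = z≤n
skip-≤ (suc c) t (suc k) = ℕ.≤-trans (s≤s (skip-≤ c t k)) (ℕ.≤-reflexive (sym (ℕ.+-suc t k)))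

skip-injective : ∀ c t {k l} → skip c t k ≡ skip c t l → k ≡ l
skip-injective zero    t               eq = ℕ.+-cancelˡ-≡ t _ _ eq
skip-injective (suc c) t {zero}  {zero}  eq = refl
skip-injective (suc c) t {suc k} {suc l} eq = cong suc (skip-injective c t (ℕ.suc-injective eq))

-- Position `c` carries the first value above the gap, so deleting it lengthens the gap by one.
skip-punchIn : ∀ {c} t (p : Fin (suc n)) (k : Fin n) → toℕ p ≡ c →
  skip c t (toℕ (punchIn p k)) ≡ skip c (suc t) (toℕ k)
skip-punchIn t zero    k       refl = ℕ.+-suc t (toℕ k)
skip-punchIn t (suc p) zero    refl = refl
skip-punchIn t (suc p) (suc k) refl = cong suc (skip-punchIn t p k refl)

-- To be applied to `a m = g (m + 1)` with `suc h` a power of two. The range from `h` to four times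
-- `h` contains every index sum in the rows that get expanded.
module _ (a : ℕ → ℤ) (h : ℕ)
  (vanishes : ∀ m → h ≤ m → m ≤ (h + h) + (h + h) → m ≢ h + h → a m ≡ 0ℤ)
  (unit : a (h + h) * a (h + h) ≡ 1ℤ)
  where

  private
    outer-vanishes : ∀ c t u {y} → c + t + u ≡ h → y ≤ h + u → y ≢ c + t → a (h + u + y) ≡ 0ℤ
    outer-vanishes c t u {y} eq y≤ y≢ = vanishes (h + u + y)
      (ℕ.≤-trans (ℕ.m≤m+n h u) (ℕ.m≤m+n (h + u) y))
      (ℕ.+-mono-≤ (ℕ.+-monoʳ-≤ h u≤h) (ℕ.≤-trans y≤ (ℕ.+-monoʳ-≤ h u≤h)))
      λ e → y≢ (ℕ.+-cancelʳ-≡ u y (c + t)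
        (trans (ℕ.+-comm y u) (trans (ℕ.+-cancelˡ-≡ h _ _ (trans (sym (ℕ.+-assoc h u y)) e)) (sym eq))))
      where
      u≤h : u ≤ h
      u≤h = subst (u ≤_) eq (ℕ.m≤n+m u (c + t))

  -- The remaining values are those below `c` and those from `c + t` to `h + u`, which gives the
  -- size. The invariant makes `c + t`, the first value above the gap, the partner of the top value
  -- `h + u`; removing both moves one unit from `u` to `t` and keeps `c`.
  det-skip : ∀ u t c → c + t + u ≡ h →
    det {u ℕ.* 2 + suc c} (λ i j → a (skip c t (toℕ i) + skip c t (toℕ j)))
      ≡ -1ℤ ^ u * (a (h + h) * det {c} (λ i j → a (toℕ i + toℕ j)))
  det-skip zero t c eq = begin
    det M
      -- The top value is now `h`, its own partner, so the surviving entry is on the diagonal.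
      ≡⟨ expand-sparse-row M (fromℕ c) (fromℕ c) sparse ⟩
    -1ℤ ^ (toℕ (fromℕ c) + toℕ (fromℕ c)) * (M (fromℕ c) (fromℕ c) * det (minor M (fromℕ c) (fromℕ c)))
      ≡⟨ cong₂ _*_ (trans (ℤ.^-distribˡ-+-* -1ℤ (toℕ (fromℕ c)) _) (sign-square (toℕ (fromℕ c))))
           (cong₂ _*_ (cong a (cong₂ _+_ last last)) (det-cong inner)) ⟩
    1ℤ * (a (h + h) * det {c} (λ i j → a (toℕ i + toℕ j))) ∎
    where
    open ≡-Reasoning
    M : Matrix (suc c)
    M i j = a (skip c t (toℕ i) + skip c t (toℕ j))

    c+t≡h : c + t ≡ h
    c+t≡h = trans (sym (ℕ.+-identityʳ (c + t))) eq

    last : skip c t (toℕ (fromℕ c)) ≡ h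
    last = trans (cong (skip c t) (trans (toℕ-fromℕ c) (sym (ℕ.+-identityʳ c))))
      (trans (skip-above c t 0) (trans (sym (ℕ.+-assoc c t 0)) eq))

    sparse : ∀ j → j ≢ fromℕ c → M (fromℕ c) j ≡ 0ℤ
    sparse j j≢ = trans (cong (λ x → a (x + skip c t (toℕ j))) (trans last (sym (ℕ.+-identityʳ h))))
      (outer-vanishes c t 0 eq
        (ℕ.≤-trans (skip-≤ c t (toℕ j))
          (ℕ.≤-trans (ℕ.+-monoʳ-≤ t (ℕ.≤-pred (toℕ<n j)))
            (ℕ.≤-reflexive (trans (ℕ.+-comm t c) (trans c+t≡h (sym (ℕ.+-identityʳ h)))))))
        λ e → j≢ (toℕ-injective (skip-injective c t (trans e (trans c+t≡h (sym last))))))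

    inner : ∀ i j → minor M (fromℕ c) (fromℕ c) i j ≡ a (toℕ i + toℕ j)
    inner i j = cong a (cong₂ _+_ (below i) (below j))
      where
      below : ∀ k → skip c t (toℕ (punchIn (fromℕ c) k)) ≡ toℕ k
      below k = trans (cong (skip c t) (trans (cong toℕ (punchIn-fromℕ k)) (toℕ-inject₁ k))) (skip-below c t k)
  det-skip (suc u) t c eq = begin
    det M
      ≡⟨ det-sparse-border M p row column ⟩
    - (M top (inject₁ p) * M (inject₁ p) top * det (λ i j → M (inject₁ (punchIn p i)) (inject₁ (punchIn p j))))
      ≡⟨ cong -_ (cong₂ _*_
           (trans (cong₂ _*_ (cong a corner) (cong a (trans (ℕ.+-comm (skip c t (toℕ (inject₁ p))) _) corner))) unit)
           (trans (det-cong inner) (det-skip u (suc t) c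
             (trans (cong (_+ u) (ℕ.+-suc c t)) (trans (sym (ℕ.+-suc (c + t) u)) eq))))) ⟩
    - (1ℤ * (-1ℤ ^ u * x))
      ≡⟨ cong -_ (ℤ.*-identityˡ _) ⟩
    - (-1ℤ ^ u * x)
      ≡⟨ ℤ.-1*i≡-i _ ⟨
    -1ℤ * (-1ℤ ^ u * x)
      ≡⟨ ℤ.*-assoc -1ℤ (-1ℤ ^ u) x ⟨
    -1ℤ ^ suc u * x ∎
    where
    open ≡-Reasoning
    m = u ℕ.* 2 + suc c
    M : Matrix (suc (suc m))
    M i j = a (skip c t (toℕ i) + skip c t (toℕ j))
    x = a (h + h) * det {c} (λ i j → a (toℕ i + toℕ j))
    top = fromℕ (suc m)

    c<1+m : c < suc m
    c<1+m = ℕ.m≤n⇒m≤1+n (ℕ.m≤n+m (suc c) (u ℕ.* 2))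
    p : Fin (suc m)
    p = fromℕ< c<1+m

    skip-p : skip c t (toℕ (inject₁ p)) ≡ c + t
    skip-p = trans (cong (skip c t) (trans (toℕ-inject₁ p) (trans (toℕ-fromℕ< c<1+m) (sym (ℕ.+-identityʳ c)))))
      (trans (skip-above c t 0) (cong (c +_) (ℕ.+-identityʳ t)))

    1+m≡c+2[1+u] : suc m ≡ c + (suc u + suc u)
    1+m≡c+2[1+u] = solve 2
      (λ c u → con 1 :+ (u :* con 2 :+ (con 1 :+ c)) := c :+ ((con 1 :+ u) :+ (con 1 :+ u))) refl c u
      where open ℕ.+-*-Solver

    t+1+m≡h+1+u : t + suc m ≡ h + suc u
    t+1+m≡h+1+u = begin
      t + suc m                  ≡⟨ cong (t +_) 1+m≡c+2[1+u] ⟩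
      t + (c + (suc u + suc u))  ≡⟨ ℕ.+-assoc t c _ ⟨
      t + c + (suc u + suc u)    ≡⟨ cong (_+ (suc u + suc u)) (ℕ.+-comm t c) ⟩
      c + t + (suc u + suc u)    ≡⟨ ℕ.+-assoc (c + t) (suc u) (suc u) ⟨
      c + t + suc u + suc u      ≡⟨ cong (_+ suc u) eq ⟩
      h + suc u                  ∎

    skip-top : skip c t (toℕ top) ≡ h + suc u
    skip-top = begin
      skip c t (toℕ top)               ≡⟨ cong (skip c t) (trans (toℕ-fromℕ (suc m)) 1+m≡c+2[1+u]) ⟩
      skip c t (c + (suc u + suc u))   ≡⟨ skip-above c t (suc u + suc u) ⟩
      c + (t + (suc u + suc u))        ≡⟨ ℕ.+-assoc c t _ ⟨
      c + t + (suc u + suc u)          ≡⟨ ℕ.+-assoc (c + t) (suc u) (suc u) ⟨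
      c + t + suc u + suc u            ≡⟨ cong (_+ suc u) eq ⟩
      h + suc u                        ∎

    skip-≤-top : ∀ (j : Fin (suc (suc m))) → skip c t (toℕ j) ≤ h + suc u
    skip-≤-top j = ℕ.≤-trans (skip-≤ c t (toℕ j))
      (ℕ.≤-trans (ℕ.+-monoʳ-≤ t (ℕ.≤-pred (toℕ<n j))) (ℕ.≤-reflexive t+1+m≡h+1+u))

    corner : skip c t (toℕ top) + skip c t (toℕ (inject₁ p)) ≡ h + h
    corner = trans (cong₂ _+_ skip-top skip-p)
      (trans (ℕ.+-assoc h (suc u) (c + t)) (cong (h +_) (trans (ℕ.+-comm (suc u) (c + t)) eq)))

    row : ∀ j → j ≢ inject₁ p → M top j ≡ 0ℤ
    row j j≢p = trans (cong (λ y → a (y + skip c t (toℕ j))) skip-top)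
      (outer-vanishes c t (suc u) eq (skip-≤-top j)
        λ e → j≢p (toℕ-injective (skip-injective c t (trans e (sym skip-p)))))

    column : ∀ i → i ≢ inject₁ p → M i top ≡ 0ℤ
    column i i≢p = trans (cong a (ℕ.+-comm (skip c t (toℕ i)) _)) (row i i≢p)

    inner : ∀ i j → M (inject₁ (punchIn p i)) (inject₁ (punchIn p j))
      ≡ a (skip c (suc t) (toℕ i) + skip c (suc t) (toℕ j))
    inner i j = cong a (cong₂ _+_ (inner₁ i) (inner₁ j))
      where
      inner₁ : ∀ k → skip c t (toℕ (inject₁ (punchIn p k))) ≡ skip c (suc t) (toℕ k)
      inner₁ k = trans (cong (skip c t) (toℕ-inject₁ (punchIn p k))) (skip-punchIn t p k (toℕ-fromℕ< c<1+m))

-- Values of `g` at and between Mersenne numbers.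

suc-pred-2^ : ∀ q → suc (2 ℕ.^ q ∸ 1) ≡ 2 ℕ.^ q
suc-pred-2^ q = ℕ.m+[n∸m]≡n (ℕ.m^n>0 2 q)

2^-cancel-< : ∀ {k l} → 2 ℕ.^ k < 2 ℕ.^ l → k < l
2^-cancel-< {k} {l} lt = ℕ.≰⇒> λ l≤k → ℕ.<⇒≱ lt (ℕ.^-monoʳ-≤ 2 l≤k)

double-mersenne : ∀ {h} q → suc h ≡ 2 ℕ.^ q → 2 ℕ.^ suc q ∸ 1 ≡ h + h + 1
double-mersenne {h} q eq = trans (cong (λ x → 2 ℕ.* x ∸ 1) (sym eq))
  (solve 1 (λ h → h :+ (con 1 :+ (h :+ con 0)) := h :+ h :+ con 1) refl h)
  where open ℕ.+-*-Solver

-- In this range `m + 2` lies strictly between 2^q and 2^(q+2), so it can only be the power 2^(q+1),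
-- and that means `m = h + h`.
g-vanishes : ∀ {h} q → suc h ≡ 2 ℕ.^ q →
  ∀ m → h ≤ m → m ≤ (h + h) + (h + h) → m ≢ h + h → g (m + 1) ≡ 0ℤ
-- The exponent 1 excludes the exceptional argument 1 = 2^1 - 1 of `g`.
g-vanishes {h} q eq m h≤m m≤4h m≢2h = g-other (m + 1) (not-mersenne 1) λ k _ → not-mersenne k
  where
  not-mersenne : ∀ k → m + 1 ≢ 2 ℕ.^ k ∸ 1
  not-mersenne k e = m≢2h (ℕ.+-cancelʳ-≡ 1 m (h + h) (trans e
      (trans (cong (λ l → 2 ℕ.^ l ∸ 1) k≡1+q) (double-mersenne q eq))))
    where
    2+m≡2^k : suc (m + 1) ≡ 2 ℕ.^ k
    2+m≡2^k = trans (cong suc e) (suc-pred-2^ k)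
    lower : 2 ℕ.^ q < 2 ℕ.^ k
    lower = subst₂ _<_ eq 2+m≡2^k (s≤s (subst (_≤ m + 1) (ℕ.+-comm h 1) (ℕ.+-monoˡ-≤ 1 h≤m)))
    upper : 2 ℕ.^ k < 2 ℕ.^ suc (suc q)
    upper = subst₂ _<_ 2+m≡2^k (cong (λ x → 2 ℕ.* (2 ℕ.* x)) eq)
      (ℕ.≤-trans (s≤s (s≤s (ℕ.+-monoˡ-≤ 1 m≤4h)))
        (ℕ.≤-trans (ℕ.n≤1+n _) (ℕ.≤-reflexive
          (solve 1 (λ h → con 3 :+ (h :+ h :+ (h :+ h) :+ con 1) := con 2 :* (con 2 :* (con 1 :+ h))) refl h))))
      where open ℕ.+-*-Solver
    k≡1+q : k ≡ suc q
    k≡1+q = ℕ.≤-antisym (ℕ.≤-pred (2^-cancel-< upper)) (2^-cancel-< lower)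

g-unit : ∀ q → g (2 ℕ.^ suc q ∸ 1) * g (2 ℕ.^ suc q ∸ 1) ≡ 1ℤ
g-unit zero    = refl
g-unit (suc q) = trans (cong₂ _*_ e e) (sign-square (suc (suc q)))
  where e = g-2^k∸1 (suc (suc q)) (s≤s (s≤s z≤n))

-- For positive `q` the number `h` is odd and the signs alternate. For `q = 0` it is 0, and `g 1`
-- and `g 3` agree: this is where the exceptional value `g 1 = 1` matters.
g-next-mersenne : ∀ q {h} → suc h ≡ 2 ℕ.^ q →
  g (2 ℕ.^ suc (suc q) ∸ 1) ≡ -1ℤ ^ h * g (2 ℕ.^ suc q ∸ 1)
g-next-mersenne zero    refl = g-2^k∸1 2 (s≤s (s≤s z≤n))
g-next-mersenne (suc q) {h} eq = begin
  g (2 ℕ.^ suc (suc (suc q)) ∸ 1)                ≡⟨ g-2^k∸1 (suc (suc (suc q))) (s≤s (s≤s z≤n)) ⟩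
  -1ℤ * -1ℤ ^ suc (suc q)                        ≡⟨ cong₂ _*_ odd (g-2^k∸1 (suc (suc q)) (s≤s (s≤s z≤n))) ⟨
  -1ℤ ^ h * g (2 ℕ.^ suc (suc q) ∸ 1)            ∎
  where
  open ≡-Reasoning
  odd : -1ℤ ^ h ≡ -1ℤ
  odd = begin
    -1ℤ ^ h                ≡⟨ ℤ.*-identityˡ _ ⟨
    1ℤ * -1ℤ ^ h           ≡⟨ ℤ.*-assoc -1ℤ -1ℤ _ ⟩
    -1ℤ * -1ℤ ^ suc h      ≡⟨ cong (λ k → -1ℤ * -1ℤ ^ k) (trans eq (ℕ.*-comm 2 (2 ℕ.^ q))) ⟩
    -1ℤ * -1ℤ ^ (2 ℕ.^ q ℕ.* 2) ≡⟨ cong (-1ℤ *_) (sign-double (2 ℕ.^ q)) ⟩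
    -1ℤ                    ∎

-- The reflection recursion for the sequence `r`.

-- The third index is the sum of the two halves, which is the `h` of the next lower power of two.
data OppositeParity : ℕ → ℕ → ℕ → Set where
  even-odd : ∀ u c → OppositeParity (u ℕ.* 2) (suc (c ℕ.* 2)) (u + c)
  odd-even : ∀ u c → OppositeParity (suc (u ℕ.* 2)) (c ℕ.* 2) (u + c)

oppositeParity : ∀ u c h → u + c ≡ suc (h ℕ.* 2) → OppositeParity u c h
oppositeParity zero          c h refl = even-odd 0 h
oppositeParity (suc zero)    c h refl = odd-even 0 h
oppositeParity (suc (suc u)) c zero ()
oppositeParity (suc (suc u)) c (suc h) eq
  with oppositeParity u c h (ℕ.suc-injective (ℕ.suc-injective eq))
... | even-odd u′ c′ = even-odd (suc u′) c′
... | odd-even u′ c′ = odd-even (suc u′) c′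

-- Exactly one of `u` and `c` is odd, and in both cases halving `u * 2 + suc c` gives the same
-- expression in their halves. The halves sum to `h`, so their joint sign is the factor in
-- `g-next-mersenne`.
r-reflect : ∀ q u c → suc (u + c) ≡ 2 ℕ.^ q →
  r (u ℕ.* 2 + suc c) ≡ -1ℤ ^ u * (g (2 ℕ.^ suc q ∸ 1) * r c)
r-reflect zero    zero zero eq = r-2n+1 0
r-reflect (suc q) u c eq = by-parity (oppositeParity u c h u+c) 1+h
  where
  h = 2 ℕ.^ q ∸ 1
  1+h : suc h ≡ 2 ℕ.^ q
  1+h = suc-pred-2^ q
  u+c : u + c ≡ suc (h ℕ.* 2)
  u+c = ℕ.suc-injective (trans eq (trans (cong (2 ℕ.*_) (sym 1+h)) (ℕ.*-comm 2 (suc h))))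

  by-parity : ∀ {u c h} → OppositeParity u c h → suc h ≡ 2 ℕ.^ q →
    r (u ℕ.* 2 + suc c) ≡ -1ℤ ^ u * (g (2 ℕ.^ suc (suc q) ∸ 1) * r c)
  by-parity (even-odd u c) 1+h = begin
    r (u ℕ.* 2 ℕ.* 2 + suc (suc (c ℕ.* 2)))
      ≡⟨ cong r (solve 2 (λ u c → u :* con 2 :* con 2 :+ (con 2 :+ c :* con 2)
           := con 2 :* (u :* con 2 :+ (con 1 :+ c))) refl u c) ⟩
    r (2 ℕ.* (u ℕ.* 2 + suc c))
      ≡⟨ trans (r-2n (u ℕ.* 2 + suc c)) (r-reflect q u c 1+h) ⟩
    su * (e * r c)
      ≡⟨ ℤ.*-identityˡ _ ⟨
    1ℤ * (su * (e * r c))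
      -- Of the two copies of `sc`, one joins `su` to raise the exponent in `g`, the other turns
      -- `r c` into `r` of the odd number `2c + 1`.
      ≡⟨ cong (_* (su * (e * r c))) (sign-square c) ⟨
    sc * sc * (su * (e * r c))
      ≡⟨ Z.solve 4 (λ sc su e x → sc Z.:* sc Z.:* (su Z.:* (e Z.:* x))
           Z.:= Z.con 1ℤ Z.:* (su Z.:* sc Z.:* e Z.:* (sc Z.:* x)))
           refl sc su e (r c) ⟩
    1ℤ * (su * sc * e * (sc * r c))
      ≡⟨ cong₂ (λ s z → s * (z * (sc * r c))) (sym (sign-double u))
           (trans (cong (_* e) (sym (ℤ.^-distribˡ-+-* -1ℤ u c))) (sym (g-next-mersenne q 1+h))) ⟩
    -1ℤ ^ (u ℕ.* 2) * (g (2 ℕ.^ suc (suc q) ∸ 1) * (sc * r c))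
      ≡⟨ cong (λ z → -1ℤ ^ (u ℕ.* 2) * (g (2 ℕ.^ suc (suc q) ∸ 1) * z))
           (trans (cong r (solve 1 (λ c → con 1 :+ c :* con 2 := con 2 :* c :+ con 1) refl c)) (r-2n+1 c)) ⟨
    -1ℤ ^ (u ℕ.* 2) * (g (2 ℕ.^ suc (suc q) ∸ 1) * r (suc (c ℕ.* 2))) ∎
    where
    open ≡-Reasoning
    open ℕ.+-*-Solver
    module Z = +-*-Solver
    e = g (2 ℕ.^ suc q ∸ 1)
    su = -1ℤ ^ u
    sc = -1ℤ ^ c
  by-parity (odd-even u c) 1+h = begin
    r (suc (u ℕ.* 2) ℕ.* 2 + suc (c ℕ.* 2))
      ≡⟨ cong r (solve 2 (λ u c → (con 1 :+ u :* con 2) :* con 2 :+ (con 1 :+ c :* con 2)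
           := con 2 :* (u :* con 2 :+ (con 1 :+ c)) :+ con 1) refl u c) ⟩
    r (2 ℕ.* (u ℕ.* 2 + suc c) + 1)
      ≡⟨ r-2n+1 (u ℕ.* 2 + suc c) ⟩
    -1ℤ ^ (u ℕ.* 2 + suc c) * r (u ℕ.* 2 + suc c)
      ≡⟨ cong₂ _*_ (ℤ.^-distribˡ-+-* -1ℤ (u ℕ.* 2) (suc c)) (r-reflect q u c 1+h) ⟩
    s * (-1ℤ * sc) * (su * (e * r c))
      -- Here `sc` comes from the odd rule for `r`; the remaining -1 is the sign of the odd number
      -- `suc (u * 2)`.
      ≡⟨ Z.solve 5 (λ s sc su e x → s Z.:* (Z.con -1ℤ Z.:* sc) Z.:* (su Z.:* (e Z.:* x))
           Z.:= Z.con -1ℤ Z.:* s Z.:* (su Z.:* sc Z.:* e Z.:* x))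
           refl s sc su e (r c) ⟩
    -1ℤ * s * (su * sc * e * r c)
      ≡⟨ cong₂ (λ y z → -1ℤ * s * (y * z))
           (trans (cong (_* e) (sym (ℤ.^-distribˡ-+-* -1ℤ u c))) (sym (g-next-mersenne q 1+h)))
           (trans (sym (r-2n c)) (cong r (ℕ.*-comm 2 c))) ⟩
    -1ℤ ^ suc (u ℕ.* 2) * (g (2 ℕ.^ suc (suc q) ∸ 1) * r (c ℕ.* 2)) ∎
    where
    open ≡-Reasoning
    open ℕ.+-*-Solver
    module Z = +-*-Solver
    e = g (2 ℕ.^ suc q ∸ 1)
    s = -1ℤ ^ (u ℕ.* 2)
    su = -1ℤ ^ u
    sc = -1ℤ ^ c

-- Strong induction on the size of the matrix.

-- Here suc n = 2^q + u and c = 2^q - 1 - u.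
reflection : ∀ n → ∃ λ q → ∃ λ u → ∃ λ c → suc n ≡ u ℕ.* 2 + suc c × suc (u + c) ≡ 2 ℕ.^ q
reflection zero    = 0 , 0 , 0 , refl , refl
reflection (suc n) with reflection n
... | q , u , suc c , eq , 2^q = q , suc u , c ,
  trans (cong suc eq) (cong suc (ℕ.+-suc (u ℕ.* 2) (suc c))) ,
  trans (cong suc (sym (ℕ.+-suc u c))) 2^q
-- Here `suc n` is 2^(q+1) - 1, so its successor is the next power of two: `u` restarts at 0 and `c`
-- at 2^(q+1) - 1.
... | q , u , zero , eq , 2^q = suc q , 0 , suc (u ℕ.* 2) ,
  cong suc (trans eq (ℕ.+-comm (u ℕ.* 2) 1)) ,
  trans (solve 1 (λ u → con 2 :+ u :* con 2 := con 2 :* (con 1 :+ (u :+ con 0))) refl u) (cong (2 ℕ.*_) 2^q)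
  where open ℕ.+-*-Solver

theorem5p11 : (n : ℕ) → det {n} (λ i j → g (toℕ i + toℕ j + 1)) ≡ r n
theorem5p11 = <-rec Hankel≡r step
  where
  Hankel≡r : ℕ → Set
  Hankel≡r n = det {n} (λ i j → g (toℕ i + toℕ j + 1)) ≡ r n

  step : ∀ n → (∀ {m} → m < n → Hankel≡r m) → Hankel≡r n
  step zero    _   = refl
  step (suc n) rec with reflection n
  ... | q , u , c , eq , 2^q = subst Hankel≡r (sym eq) (begin
    det {u ℕ.* 2 + suc c} (λ i j → g (toℕ i + toℕ j + 1))
      -- The full Hankel matrix is the case of an empty gap.
      ≡⟨ det-cong {u ℕ.* 2 + suc c} (λ i j → cong (λ m → g (m + 1))
           (cong₂ _+_ (skip-none c (toℕ i)) (skip-none c (toℕ j)))) ⟨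
    det {u ℕ.* 2 + suc c} (λ i j → g (skip c 0 (toℕ i) + skip c 0 (toℕ j) + 1))
      ≡⟨ det-skip (λ m → g (m + 1)) (u + c) (g-vanishes q 2^q)
           (subst (λ m → g m * g m ≡ 1ℤ) (double-mersenne q 2^q) (g-unit q)) u 0 c
           (trans (cong (_+ u) (ℕ.+-identityʳ c)) (ℕ.+-comm c u)) ⟩
    -1ℤ ^ u * (g (u + c + (u + c) + 1) * det {c} (λ i j → g (toℕ i + toℕ j + 1)))
      ≡⟨ cong (-1ℤ ^ u *_) (cong₂ _*_ (cong g (sym (double-mersenne q 2^q)))
           (rec (subst (c <_) (sym eq) (ℕ.m≤n+m (suc c) (u ℕ.* 2))))) ⟩
    -1ℤ ^ u * (g (2 ℕ.^ suc q ∸ 1) * r c)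
      ≡⟨ r-reflect q u c 2^q ⟨
    r (u ℕ.* 2 + suc c) ∎)
    where open ≡-Reasoning
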